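{- Let $\boldsymbol x\in\{0,1\}^\omega$ begin with $010$. Then $\boldsymbol x$ is faux-bonacci if and only if $\boldsymbol x=010\bullet\boldsymbol f$ for some $\boldsymbol f\in V$, where $V=\mathcal O^\omega-\mathcal O^*F\mathcal O^\omega$ and $$F=\alpha^*\beta(\alpha\alpha+\alpha\beta+\beta\alpha\alpha+\beta\beta\beta^*\alpha\alpha)^*(\beta\alpha\beta+\beta\beta\beta^*\alpha\beta)$$ (a regular expression over the alphabet $\mathcal O=\{\alpha,\beta\}$), i.e. $V$ is the set of $\omega$-words over $\mathcal O$ having no factor in $F$.
   Context: Words are over $\{0,1\}$ unless stated otherwise. $\varphi$ is the morphism $0\mapsto 01$, $1\mapsto 0$. For non-empty $X$, $X^-$ is $X$ with last letter erased; a $4^-$-power is $XXXX^-$ with $X$ non-empty; a binary word is faux-bonacci if it has no factor $11$ and no factor that is a $4^-$-power. The finite Fibonacci words are $F_0=0$, $F_1=01$, $F_{n+2}=F_{n+1}F_n$. The Parikh vector of a binary word $w$ is $\pi(w)=[|w|_0,|w|_1]$, with vectors compared componentwise. For $n\ge 1$ and a word $w=yF_n$ with $\pi(y)\le\pi(F_n)-\pi(0)$, define $\alpha(w)=yF_{n+1}$ and $\beta(w)=yF_{n-1}F_{n+1}$; the results again have this form with $n$ replaced by $n+1$, and $w$ is a prefix of both. Let $\mathcal O=\{\alpha,\beta\}$. For a word $w=yF_2$ with $\pi(y)\le\pi(F_2)-\pi(0)$, define $w\bullet\epsilon=w$ and $w\bullet(f\gamma)=(w\bullet f)\bullet\gamma$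 for $f\in\mathcal O^*$, $\gamma\in\mathcal O$, where, if $f$ has length $k$, $w\bullet f$ has the form $y'F_{k+2}$ with $\pi(y')\le\pi(F_{k+2})-\pi(0)$ and $\gamma$ is applied with index $n=k+2$. For $\boldsymbol f=f_1f_2\cdots\in\mathcal O^\omega$, $w\bullet\boldsymbol f=\lim_{n\to\infty} w\bullet(f_1\cdots f_n)$ (each term is a prefix of the next). $\mathcal O^*F\mathcal O^\omega$ denotes the set of $\omega$-words over $\mathcal O$ having a factor in the language $F$. -}

module Defs where

open import Data.Nat using (ℕ; zero; suc; _+_)
open import Data.List using (List; []; _∷_; _++_; replicate; length)
open import Data.Product using (Σ; _×_; _,_)
open import Relation.Binary.PropositionalEquality using (_≡_)
open import Relation.Nullary using (¬_)

data Bit : Set where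
  𝟎 𝟏 : Bit

Word∞ : Set → Set
Word∞ A = ℕ → A

segment : {A : Set} → Word∞ A → ℕ → ℕ → List A
segment x i zero    = []
segment x i (suc n) = x i ∷ segment x (suc i) n

HasFactor : {A : Set} → (List A → Set) → Word∞ A → Set
HasFactor P x = Σ ℕ λ i → Σ ℕ λ n → P (segment x i n)

IsPrefix : {A : Set} → List A → Word∞ A → Set
IsPrefix w x = segment x 0 (length w) ≡ w

dropLast : {A : Set} → List A → List A
dropLast []           = []
dropLast (a ∷ [])     = []
dropLast (a ∷ b ∷ t)  = a ∷ dropLast (b ∷ t)

FourMinusPower : List Bit → Set
FourMinusPower w = Σ Bit λ a → Σ (List Bit) λ t →
  let X = a ∷ t in w ≡ X ++ X ++ X ++ dropLast X

Is11 : List Bit → Set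
Is11 w = w ≡ 𝟏 ∷ 𝟏 ∷ []

FauxBonacci : Word∞ Bit → Set
FauxBonacci x = ¬ HasFactor Is11 x × ¬ HasFactor FourMinusPower x

fib : ℕ → List Bit
fib zero          = 𝟎 ∷ []
fib (suc zero)    = 𝟎 ∷ 𝟏 ∷ []
fib (suc (suc n)) = fib (suc n) ++ fib n

data Op : Set where
  α β : Op

-- For w = y F₂ and f = f₁ f₂ ⋯ (f k is the letter f_{k+1}),
-- w • (f₁ ⋯ f_k) = (yPart y f k) F_{k+2}.
-- α : y F_n ↦ y F_{n+1}  (y unchanged);
-- β : y F_n ↦ (y F_{n-1}) F_{n+1}; the (k+1)-st operation is applied
-- with n = k+2, so β appends F_{k+1} to y.
yPart : List Bit → Word∞ Op → ℕ → List Bit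
yPart y f zero = y
yPart y f (suc k) with f k
... | α = yPart y f k
... | β = yPart y f k ++ fib (suc k)

bulletFin : List Bit → Word∞ Op → ℕ → List Bit
bulletFin y f k = yPart y f k ++ fib (suc (suc k))

-- x = (y F₂) • f : x is the limit of the increasing chain of prefixes
-- (y F₂) • (f₁ ⋯ f_k), i.e. every term of the chain is a prefix of x.
_•∞_≡_ : List Bit → Word∞ Op → Word∞ Bit → Set
y •∞ f ≡ x = (k : ℕ) → IsPrefix (bulletFin y f k) x

data Block : List Op → Set where
  αα   : Block (α ∷ α ∷ [])
  αβ   : Block (α ∷ β ∷ [])
  βαα  : Block (β ∷ α ∷ α ∷ [])
  ββαα : (k : ℕ) → Block (β ∷ β ∷ replicate k β ++ α ∷ α ∷ [])

data Blocks : List Op → Set where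
  []  : Blocks []
  _∷_ : {u v : List Op} → Block u → Blocks v → Blocks (u ++ v)

data Tail : List Op → Set where
  βαβ   : Tail (β ∷ α ∷ β ∷ [])
  ββαβ  : (k : ℕ) → Tail (β ∷ β ∷ replicate k β ++ α ∷ β ∷ [])

InF : List Op → Set
InF w = Σ ℕ λ i → Σ (List Op) λ u → Σ (List Op) λ v →
  Blocks u × Tail v × w ≡ replicate i α ++ β ∷ u ++ v

InV : Word∞ Op → Set
InV f = ¬ HasFactor InF f

{-# OPTIONS --safe #-}

-- Write 010 • f as a limit: α is x ↦ φ(x) and β is x ↦ φ(0x), where x = 010 • f′
-- for the remaining operations f′.  Since φ(z) is faux-bonacci exactly when z is,
-- 010 • f fails to be faux-bonacci only if, after some β, the word 0x has a
-- 4⁻-power as a prefix.  Desubstituting this prefix through the following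
-- operations, each of which shortens its period, gives a run of a finite automaton
-- on f′ that must stop, and it can only stop after a prefix in Blocks · Tail;
-- conversely, such a run can be traced back to a 4⁻-power.
module Submission where

open import Defs
open import Data.Empty using (⊥; ⊥-elim)
open import Data.List using (List; []; _∷_; [_]; _++_; _∷ʳ_; length; replicate; initLast; _∷ʳ′_)
open import Data.List.Properties using (++-assoc; ++-identityʳ; ++-monoid; ∷-injectiveˡ; ∷-injectiveʳ; length-++)
open import Data.Nat using (ℕ; zero; suc; _+_; _≤_; _<_; z≤n; s≤s)
open import Data.Nat.Properties using (module ≤-Reasoning; ≤-refl; ≤-trans; ≤-reflexive; n≤1+n; m≤n⇒m≤1+n; m≤m+n;
  +-comm; +-suc)
open import Data.Product using (Σ; ∃; ∃₂; _×_; _,_; proj₂)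
open import Data.Sum using (_⊎_; inj₁; inj₂)
open import Data.Unit using (⊤; tt)
open import Function using (_∘_)
open import Function.Bundles using (_⇔_; mk⇔)
open import Relation.Binary.PropositionalEquality using (_≡_; refl; sym; trans; cong; subst; module ≡-Reasoning)
open import Relation.Nullary using (¬_)
open import Tactic.MonoidSolver using (solve)

-- The 0 that β puts in front of x is decoded together with x: as 0 = φ(1) and x = φ(s x′), where s
-- is empty or 0 according to the next operation, 0x = φ(1 s x′). A 4⁻-power at the start of 0x thus
-- pulls back to one starting with 1, and deleting this 1 leaves (U01)³U at the start of s x′. The
-- one ambiguity is that φ(1) = 0 is a prefix of φ(0) = 01, so the last letter of the last,
-- incomplete copy of a period can be misread. The states record a prefix of 0x: a 4⁻-power in
-- `AfterBeta`, some (U01)³U in `AfterBetas`, which becomes a 4⁻-power if a 0 follows. The run stops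
-- when 0x begins with (001)³01.

-- Desubstitution of words and powers under φ.

φ : List Bit → List Bit
φ []      = []
φ (𝟎 ∷ w) = 𝟎 ∷ 𝟏 ∷ φ w
φ (𝟏 ∷ w) = 𝟎 ∷ φ w

φ-++ : ∀ u v → φ (u ++ v) ≡ φ u ++ φ v
φ-++ []      v = refl
φ-++ (𝟎 ∷ u) v = cong (λ t → 𝟎 ∷ 𝟏 ∷ t) (φ-++ u v)
φ-++ (𝟏 ∷ u) v = cong (𝟎 ∷_) (φ-++ u v)

φ-injective : ∀ u v → φ u ≡ φ v → u ≡ v
φ-injective []      []            e = refl
φ-injective []      (𝟎 ∷ v)       ()
φ-injective []      (𝟏 ∷ v)       ()
φ-injective (𝟎 ∷ u) []            ()
φ-injective (𝟏 ∷ u) []            ()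
φ-injective (𝟎 ∷ u) (𝟎 ∷ v)       e = cong (𝟎 ∷_) (φ-injective u v (∷-injectiveʳ (∷-injectiveʳ e)))
φ-injective (𝟎 ∷ u) (𝟏 ∷ [])      ()
φ-injective (𝟎 ∷ u) (𝟏 ∷ 𝟎 ∷ v)   ()
φ-injective (𝟎 ∷ u) (𝟏 ∷ 𝟏 ∷ v)   ()
φ-injective (𝟏 ∷ [])    (𝟎 ∷ v)   ()
φ-injective (𝟏 ∷ 𝟎 ∷ u) (𝟎 ∷ v)   ()
φ-injective (𝟏 ∷ 𝟏 ∷ u) (𝟎 ∷ v)   ()
φ-injective (𝟏 ∷ u) (𝟏 ∷ v)       e = cong (𝟏 ∷_) (φ-injective u v (∷-injectiveʳ e))

length≤length-φ : ∀ u → length u ≤ length (φ u)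
length≤length-φ []      = z≤n
length≤length-φ (𝟎 ∷ u) = s≤s (m≤n⇒m≤1+n (length≤length-φ u))
length≤length-φ (𝟏 ∷ u) = s≤s (length≤length-φ u)

length-∷ʳ : ∀ {A : Set} (u : List A) a → length (u ∷ʳ a) ≡ suc (length u)
length-∷ʳ u a = trans (length-++ u) (+-comm (length u) 1)

-- A 4⁻-power is quad Y [ b ] [], for an arbitrary word Y and letter b.
quad : List Bit → List Bit → List Bit → List Bit
quad V s r = V ++ s ++ V ++ s ++ V ++ s ++ V ++ r

φ-quad : ∀ V s r → φ (quad V s r) ≡ quad (φ V) (φ s) (φ r)
φ-quad V s r
  rewrite φ-++ V (s ++ V ++ s ++ V ++ s ++ V ++ r) | φ-++ s (V ++ s ++ V ++ s ++ V ++ r)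
        | φ-++ V (s ++ V ++ s ++ V ++ r) | φ-++ s (V ++ s ++ V ++ r)
        | φ-++ V (s ++ V ++ r) | φ-++ s (V ++ r) | φ-++ V r = refl

quad-shiftʳ : ∀ V c s r → quad (V ++ c) s r ≡ quad V (c ++ s) (c ++ r)
quad-shiftʳ V c s r = solve (++-monoid Bit)

quad-shiftˡ : ∀ c V s r → c ++ quad V (s ++ c) r ≡ quad (c ++ V) s r
quad-shiftˡ c V s r = solve (++-monoid Bit)

quad-absorb : ∀ c Y s r → c ++ quad (Y ++ s) c r ≡ quad (c ++ Y) s (s ++ r)
quad-absorb c Y s r = solve (++-monoid Bit)

quad-++ : ∀ V s r t → quad V s r ++ t ≡ quad V s (r ++ t)
quad-++ V s r t = solve (++-monoid Bit)

-- The part of being faux-bonacci that every 010 • f has, whatever f is: a factor 000 of φ(w) needs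
-- a factor 11 of w.
Ok : List Bit → Set
Ok []              = ⊤
Ok (𝟏 ∷ 𝟏 ∷ w)     = ⊥
Ok (𝟎 ∷ 𝟎 ∷ 𝟎 ∷ w) = ⊥
Ok (a ∷ w)         = Ok w

Ok-tail : ∀ a w → Ok (a ∷ w) → Ok w
Ok-tail 𝟎 []          o = o
Ok-tail 𝟎 (𝟎 ∷ [])    o = o
Ok-tail 𝟎 (𝟎 ∷ 𝟏 ∷ w) o = o
Ok-tail 𝟎 (𝟏 ∷ w)     o = o
Ok-tail 𝟏 []          o = o
Ok-tail 𝟏 (𝟎 ∷ w)     o = o

Ok-suffix : ∀ p {w} → Ok (p ++ w) → Ok w
Ok-suffix []      o = o
Ok-suffix (a ∷ p) o = Ok-suffix p (Ok-tail a _ o)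

Ok-φ : ∀ w → Ok w → Ok (φ w)
Ok-φ []          o = tt
Ok-φ (𝟎 ∷ [])    o = tt
Ok-φ (𝟎 ∷ 𝟎 ∷ w) o = Ok-φ (𝟎 ∷ w) (Ok-tail 𝟎 (𝟎 ∷ w) o)
Ok-φ (𝟎 ∷ 𝟏 ∷ w) o = Ok-φ (𝟏 ∷ w) o
Ok-φ (𝟏 ∷ [])    o = tt
Ok-φ (𝟏 ∷ 𝟎 ∷ w) o = Ok-φ (𝟎 ∷ w) o

-- A position in φ(w) is a block boundary exactly when the rest of the word is empty or starts with
-- 0.
NotOne : List Bit → Set
NotOne (𝟏 ∷ _) = ⊥
NotOne _       = ⊤

NotOne-φ : ∀ w {u} → φ w ≡ u → NotOne u
NotOne-φ []      refl = tt
NotOne-φ (𝟎 ∷ w) refl = tt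
NotOne-φ (𝟏 ∷ w) refl = tt

NotOne-++ : ∀ u {r} → NotOne u → NotOne r → NotOne (u ++ r)
NotOne-++ []      n m = m
NotOne-++ (𝟎 ∷ u) n m = tt

NotOne-head : ∀ u {r} → NotOne (u ++ r) → NotOne u
NotOne-head []      n = tt
NotOne-head (𝟎 ∷ u) n = tt

φ-cut : ∀ w u {s} → φ w ≡ u ++ s → NotOne s →
  ∃₂ λ w₁ w₂ → w ≡ w₁ ++ w₂ × φ w₁ ≡ u × φ w₂ ≡ s
φ-cut w       []          e n = [] , w , refl , refl , e
φ-cut []      (a ∷ u)     ()
φ-cut (𝟎 ∷ w) (𝟏 ∷ u)     ()
φ-cut (𝟏 ∷ w) (𝟏 ∷ u)     ()
φ-cut (𝟎 ∷ w) (𝟎 ∷ 𝟎 ∷ u) ()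
φ-cut (𝟎 ∷ w) (𝟎 ∷ []) {𝟏 ∷ s} e ()
φ-cut (𝟎 ∷ w) (𝟎 ∷ 𝟏 ∷ u) e n with φ-cut w u (∷-injectiveʳ (∷-injectiveʳ e)) n
... | w₁ , w₂ , refl , refl , e₂ = 𝟎 ∷ w₁ , w₂ , refl , refl , e₂
φ-cut (𝟏 ∷ w) (𝟎 ∷ u)     e n with φ-cut w u (∷-injectiveʳ e) n
... | w₁ , w₂ , refl , refl , e₂ = 𝟏 ∷ w₁ , w₂ , refl , refl , e₂

-- The letter 1 is misread exactly when φ(1) = 0 is continued to φ(0) = 01.
φ-prefix : ∀ y P {r} → φ y ≡ φ P ++ r →
  (∃ λ t → y ≡ P ++ t × φ t ≡ r) ⊎
  (∃₂ λ W t → P ≡ W ∷ʳ 𝟏 × y ≡ W ++ 𝟎 ∷ t × r ≡ 𝟏 ∷ φ t)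
φ-prefix y       []          e = inj₁ (y , refl , e)
φ-prefix []      (𝟎 ∷ P)     ()
φ-prefix []      (𝟏 ∷ P)     ()
φ-prefix (𝟎 ∷ y) (𝟏 ∷ [])    e = inj₂ ([] , y , refl , refl , sym (∷-injectiveʳ e))
φ-prefix (𝟎 ∷ y) (𝟏 ∷ 𝟎 ∷ P) ()
φ-prefix (𝟎 ∷ y) (𝟏 ∷ 𝟏 ∷ P) ()
φ-prefix (𝟏 ∷ [])    (𝟎 ∷ P) ()
φ-prefix (𝟏 ∷ 𝟎 ∷ y) (𝟎 ∷ P) ()
φ-prefix (𝟏 ∷ 𝟏 ∷ y) (𝟎 ∷ P) ()
φ-prefix (𝟎 ∷ y) (𝟎 ∷ P) e with φ-prefix y P (∷-injectiveʳ (∷-injectiveʳ e))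
... | inj₁ (t , refl , e′)            = inj₁ (t , refl , e′)
... | inj₂ (W , t , refl , refl , e′) = inj₂ (𝟎 ∷ W , t , refl , refl , e′)
φ-prefix (𝟏 ∷ y) (𝟏 ∷ P) e with φ-prefix y P (∷-injectiveʳ e)
... | inj₁ (t , refl , e′)            = inj₁ (t , refl , e′)
... | inj₂ (W , t , refl , refl , e′) = inj₂ (𝟏 ∷ W , t , refl , refl , e′)

NotOne-φ-++ : ∀ a s {r} → NotOne (φ (a ∷ s) ++ r)
NotOne-φ-++ 𝟎 s = tt
NotOne-φ-++ 𝟏 s = tt

φ-cut-both : ∀ w u a s {r} → φ w ≡ u ++ φ (a ∷ s) ++ r → NotOne r →
  ∃₂ λ V y → φ V ≡ u × w ≡ V ++ (a ∷ s) ++ y × φ y ≡ r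
φ-cut-both w u a s e n with φ-cut w u e (NotOne-φ-++ a s)
... | V , w₂ , refl , eV , e₂ with φ-cut w₂ (φ (a ∷ s)) e₂ n
... | s′ , y , refl , es , ey with φ-injective s′ (a ∷ s) es
... | refl = V , y , eV , refl , ey

-- The first three copies of U are followed by a block, so they end at boundaries and share one
-- preimage V; only the last copy, followed by r, can be misread. The condition on `U ++ r` is the
-- boundary before that copy; it matters when U is empty.
φ-quad⁻¹ : ∀ w U a s {r} → φ w ≡ quad U (φ (a ∷ s)) r → NotOne (U ++ r) →
  ∃ λ V → φ V ≡ U ×
    ((∃ λ t → w ≡ quad V (a ∷ s) t × φ t ≡ r) ⊎
     (∃₂ λ W t → V ≡ W ∷ʳ 𝟏 × w ≡ quad W (𝟏 ∷ a ∷ s) (𝟎 ∷ t) × r ≡ 𝟏 ∷ φ t))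
φ-quad⁻¹ w U a s {r} e n
  with nU ← NotOne-head U (NotOne-φ w e)
  with φ-cut-both w U a s e (NotOne-++ U nU (NotOne-φ-++ a s))
... | V , w₁ , refl , refl , e₁ with φ-cut-both w₁ (φ V) a s e₁ (NotOne-++ (φ V) nU (NotOne-φ-++ a s))
... | V₁ , w₂ , eV₁ , refl , e₂ with φ-injective V₁ V eV₁
... | refl with φ-cut-both w₂ (φ V) a s e₂ n
... | V₂ , w₃ , eV₂ , refl , e₃ with φ-injective V₂ V eV₂
... | refl with φ-prefix w₃ V e₃
... | inj₁ (t , refl , et)            = V , refl , inj₁ (t , refl , et)
... | inj₂ (W , t , refl , refl , et) = W ∷ʳ 𝟏 , refl , inj₂ (W , t , refl , lemma W [ 𝟏 ] (a ∷ s) (𝟎 ∷ t) , et)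
  where
  lemma : ∀ W o c t → (W ++ o) ++ c ++ (W ++ o) ++ c ++ (W ++ o) ++ c ++ W ++ t ≡ quad W (o ++ c) t
  lemma W o c t = solve (++-monoid Bit)

unsnoc : ∀ (a : Bit) u → ∃₂ λ v b → a ∷ u ≡ v ∷ʳ b
unsnoc a []      = [] , a , refl
unsnoc a (c ∷ u) with unsnoc c u
... | v , b , eq = a ∷ v , b , cong (a ∷_) eq

¬Ok-11 : ∀ p u {r} → ¬ Ok (p ++ (u ∷ʳ 𝟏) ++ 𝟏 ∷ r)
¬Ok-11 p u {r} o = Ok-suffix u (subst Ok (++-assoc u [ 𝟏 ] (𝟏 ∷ r)) (Ok-suffix p o))

-- If b = 0, it is the block φ(1); the preimage of `𝟎 ∷ T` then ends in 0, whose block has two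
-- letters, so the length drops. If b = 1, the letter before it must be 0; moving this 0 out of
-- `𝟎 ∷ T` leaves the block 01 = φ(0) at the end of the period and shortens the rest.
φ-power⁻¹-𝟎 : ∀ w p T b {r} → Ok w → φ w ≡ p ++ quad (𝟎 ∷ T) [ b ] r →
  ∃ λ q → ∃ λ Z → ∃ λ b′ → ∃ λ s →
    w ≡ q ++ quad Z [ b′ ] s × φ q ≡ p × length Z < length (𝟎 ∷ T)
φ-power⁻¹-𝟎 w p T b ok e with φ-cut w p e tt
φ-power⁻¹-𝟎 w p T 𝟎 ok e | q , w₁ , refl , eq , e₁ with φ-quad⁻¹ w₁ (𝟎 ∷ T) 𝟏 [] e₁ tt
... | _ , _ , inj₂ (W , _ , refl , refl , _) = ⊥-elim (Ok-suffix W (Ok-suffix q ok))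
... | V , eV , inj₁ (t , refl , _) with initLast V
φ-power⁻¹-𝟎 w p T 𝟎 ok e | q , w₁ , refl , eq , e₁ | V , () , inj₁ (t , refl , _) | []
... | V′ ∷ʳ′ 𝟏 = ⊥-elim (¬Ok-11 q V′ ok)
... | V′ ∷ʳ′ 𝟎 = q , V′ ∷ʳ 𝟎 , 𝟏 , t , refl , eq , (begin-strict
      length (V′ ∷ʳ 𝟎)            ≡⟨ length-∷ʳ V′ 𝟎 ⟩
      suc (length V′)             ≤⟨ s≤s (length≤length-φ V′) ⟩
      suc (length (φ V′))         <⟨ ≤-refl ⟩
      suc (suc (length (φ V′)))   ≡⟨ +-comm 2 _ ⟩
      length (φ V′) + 2           ≡⟨ length-++ (φ V′) ⟨
      length (φ V′ ++ 𝟎 ∷ 𝟏 ∷ []) ≡⟨ cong length (trans (sym (φ-++ V′ [ 𝟎 ])) eV) ⟩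
      length (𝟎 ∷ T)              ∎)
  where open ≤-Reasoning
φ-power⁻¹-𝟎 w p T 𝟏 {r} ok e | q , w₁ , refl , eq , e₁ with unsnoc 𝟎 T
... | Y , 𝟏 , eY = ⊥-elim (¬Ok-11 p Y (subst (λ y → Ok (p ++ quad y [ 𝟏 ] r)) eY (subst Ok e (Ok-φ (q ++ w₁) ok))))
... | Y , 𝟎 , eY with e₂ ← trans e₁ (trans (cong (λ y → quad y [ 𝟏 ] r) eY) (quad-shiftʳ Y [ 𝟎 ] [ 𝟏 ] r))
  with φ-quad⁻¹ w₁ Y 𝟎 [] e₂ (NotOne-++ Y (NotOne-head Y (NotOne-φ w₁ e₂)) tt)
... | V , refl , inj₁ (t , refl , _) = q , V , 𝟎 , t , refl , eq ,
      ≤-trans (s≤s (length≤length-φ V)) (≤-reflexive (trans (sym (length-∷ʳ (φ V) 𝟎)) (cong length (sym eY))))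

φ-power⁻¹ : ∀ w p Y b {r} → Ok w → φ w ≡ p ++ quad Y [ b ] r →
  ∃ λ q → ∃ λ Z → ∃ λ b′ → ∃ λ s → w ≡ q ++ quad Z [ b′ ] s × length Z < length Y
φ-power⁻¹ w p [] b {r} ok e with b | Ok-suffix p {b ∷ b ∷ b ∷ r} (subst Ok e (Ok-φ w ok))
... | 𝟎 | ()
... | 𝟏 | ()
φ-power⁻¹ w p (𝟎 ∷ T) b ok e with φ-power⁻¹-𝟎 w p T b ok e
... | q , Z , b′ , s , eq , _ , lt = q , Z , b′ , s , eq , lt
φ-power⁻¹ w p (𝟏 ∷ T) 𝟏 ok e = ⊥-elim (Ok-suffix (𝟏 ∷ T) (Ok-suffix p (subst Ok e (Ok-φ w ok))))
φ-power⁻¹ w p (𝟏 ∷ T) 𝟎 ok e with initLast p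
... | [] = ⊥-elim (NotOne-φ w e)
... | p′ ∷ʳ′ 𝟏 = ⊥-elim (¬Ok-11 [] p′ (subst Ok e (Ok-φ w ok)))
-- The power 1U·0 is preceded by 0, which makes it a full fourth power of 01U.
... | p′ ∷ʳ′ 𝟎 with unsnoc 𝟏 T
φ-power⁻¹ w .(p′ ∷ʳ 𝟎) (𝟏 ∷ T) 𝟎 {r} ok e | p′ ∷ʳ′ 𝟎 | Y , b , eY
  with e₁ ← trans e (trans (++-assoc p′ [ 𝟎 ] _)
              (cong (p′ ++_) (trans (cong (λ y → 𝟎 ∷ quad y [ 𝟎 ] r) eY) (quad-absorb [ 𝟎 ] Y [ b ] r))))
  with φ-power⁻¹-𝟎 w p′ Y b ok e₁
... | q , Z , b′ , s , eq , _ , lt = q , Z , b′ , s , eq ,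
      subst (length Z <_) (sym (trans (cong length eY) (length-∷ʳ Y b))) lt

-- A must end in 0, so the period ends in 0101 = φ(00) and the last copy is followed by 00. In the
-- preimage, S is followed by 00 inside the period and finally by 1: S ending in 0 gives 000, S
-- ending in 1 gives 11.
¬φ-quad-101 : ∀ w A {r} → Ok w → ¬ φ w ≡ quad A (𝟏 ∷ 𝟎 ∷ 𝟏 ∷ []) (𝟎 ∷ r)
¬φ-quad-101 w A ok e with initLast A
... | [] = NotOne-φ w e
... | A′ ∷ʳ′ 𝟏 = ¬Ok-11 [] A′ (subst Ok e (Ok-φ w ok))
¬φ-quad-101 w _ {r} ok e | A′ ∷ʳ′ 𝟎 with e₁ ← trans e (quad-shiftʳ A′ [ 𝟎 ] (𝟏 ∷ 𝟎 ∷ 𝟏 ∷ []) (𝟎 ∷ r))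
  with φ-quad⁻¹ w A′ 𝟎 (𝟎 ∷ []) e₁ (NotOne-++ A′ (NotOne-head A′ (NotOne-φ w e₁)) tt)
... | S , _ , inj₁ (t , refl , et) with initLast S
¬φ-quad-101 w _ {r} () e | A′ ∷ʳ′ 𝟎 | _ , _ , inj₁ (t , refl , et) | []
... | S′ ∷ʳ′ 𝟎 = Ok-suffix S′ (subst Ok (++-assoc S′ [ 𝟎 ] _) ok)
¬φ-quad-101 w _ {r} ok e | A′ ∷ʳ′ 𝟎 | _ , _ , inj₁ (𝟏 ∷ t , refl , et) | S′ ∷ʳ′ 𝟏 =
  ¬Ok-11 (S ++ c ++ S ++ c ++ S ++ c) S′ (subst Ok (reassoc S c (𝟏 ∷ t)) ok)
  where
  S = S′ ∷ʳ 𝟏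
  c = 𝟎 ∷ 𝟎 ∷ []
  reassoc : ∀ S c t → quad S c t ≡ (S ++ c ++ S ++ c ++ S ++ c) ++ S ++ t
  reassoc S c t = solve (++-monoid Bit)

-- The finite words produced by the operations.

tl : {A : Set} → Word∞ A → Word∞ A
tl x n = x (suc n)

sep : Op → List Bit
sep α = []
sep β = [ 𝟎 ]

-- 010 • f₁ ⋯ f_m is expand (010) m f: read from the first operation on, α and β
-- are x ↦ φ(x) and x ↦ φ(0x) on the word produced by the later operations.
expand : List Bit → ℕ → Word∞ Op → List Bit
expand u zero    f = u
expand u (suc m) f = φ (sep (f 0) ++ expand u m (tl f))

word : ℕ → Word∞ Op → List Bit
word = expand (𝟎 ∷ 𝟏 ∷ 𝟎 ∷ [])

word-010 : ∀ m f → ∃ λ r → word m f ≡ 𝟎 ∷ 𝟏 ∷ 𝟎 ∷ r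
word-010 zero    f = [] , refl
word-010 (suc m) f with f 0 | word m (tl f) | word-010 m (tl f)
... | α | _ | r , refl = _ , refl
... | β | _ | r , refl = _ , refl

Ok-word : ∀ m f → Ok (word m f)
Ok-sep-word : ∀ o m f → Ok (sep o ++ word m f)

Ok-word zero    f = tt
Ok-word (suc m) f = Ok-φ (sep (f 0) ++ word m (tl f)) (Ok-sep-word (f 0) m (tl f))

Ok-sep-word α m f = Ok-word m f
Ok-sep-word β m f with word m f | word-010 m f | Ok-word m f
... | _ | r , refl | ok = ok

Ok-𝟏-sep-word : ∀ o m f → Ok (𝟏 ∷ sep o ++ word m f)
Ok-𝟏-sep-word β m f = Ok-sep-word β m f
Ok-𝟏-sep-word α m f with word m f | word-010 m f | Ok-word m f
... | _ | r , refl | ok = ok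

-- The remainder r is for m = 0, where 010 is a proper prefix of φ(010) and of φ(0010).
word-φ : ∀ m f → ∃₂ λ m′ r → φ (sep (f 0) ++ word m′ (tl f)) ≡ word m f ++ r
word-φ (suc m) f = m , [] , sym (++-identityʳ _)
word-φ zero    f with f 0
... | α = 0 , _ , refl
... | β = 0 , _ , refl

-- With `d` equal to `[ 𝟏 ]`, φ d is the 0 inserted by β.
quad-word-φ : ∀ d p V s {r} m f → p ++ quad V s r ≡ φ d ++ word m f →
  ∃₂ λ m′ r′ → φ (d ++ sep (f 0) ++ word m′ (tl f)) ≡ p ++ quad V s (r ++ r′)
quad-word-φ d p V s {r} m f e with word-φ m f
... | m′ , r′ , e′ = m′ , r′ , (begin
  φ (d ++ sep (f 0) ++ word m′ (tl f))      ≡⟨ φ-++ d _ ⟩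
  φ d ++ φ (sep (f 0) ++ word m′ (tl f))    ≡⟨ cong (φ d ++_) e′ ⟩
  φ d ++ word m f ++ r′                     ≡⟨ ++-assoc (φ d) _ r′ ⟨
  (φ d ++ word m f) ++ r′                   ≡⟨ cong (_++ r′) e ⟨
  (p ++ quad V s r) ++ r′                   ≡⟨ ++-assoc p _ r′ ⟩
  p ++ quad V s r ++ r′                     ≡⟨ cong (p ++_) (quad-++ V s r r′) ⟩
  p ++ quad V s (r ++ r′)                   ∎)
  where open ≡-Reasoning

-- The automaton of the language Blocks · Tail: AfterBeta f holds iff f has a prefix
-- in it (α? is the choice between αα and αβ), AfterBetas f iff βf does.
data AfterBeta  (f : Word∞ Op) : Set
data AfterBetas (f : Word∞ Op) : Set

data AfterBeta f where
  α? : f 0 ≡ α → AfterBeta (tl (tl f)) → AfterBeta f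
  β+ : f 0 ≡ β → AfterBetas (tl f) → AfterBeta f

data AfterBetas f where
  β+ : f 0 ≡ β → AfterBetas (tl f) → AfterBetas f
  αα : f 0 ≡ α → f 1 ≡ α → AfterBeta (tl (tl f)) → AfterBetas f
  αβ : f 0 ≡ α → f 1 ≡ β → AfterBetas f

data Bad (f : Word∞ Op) : Set where
  here  : f 0 ≡ β → AfterBeta (tl f) → Bad f
  there : Bad (tl f) → Bad f

-- Without a bad run there is no 4⁻-power.

NotOne-quad-01 : ∀ U r w → Ok w → NotOne w → w ≡ quad U (𝟎 ∷ 𝟏 ∷ []) r → NotOne (U ++ r)
NotOne-quad-01 []      []      w ok n refl = tt
NotOne-quad-01 []      (𝟎 ∷ r) w ok n refl = tt
NotOne-quad-01 (𝟎 ∷ U) r       w ok n refl = tt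

quad-misread : ∀ W r → 𝟎 ∷ quad W (𝟏 ∷ 𝟎 ∷ []) r ≡ quad (𝟎 ∷ W) [ 𝟏 ] r
quad-misread W r = quad-shiftˡ [ 𝟎 ] W [ 𝟏 ] r

-- The left side starts with 00, hence so does W, and 10 followed by W contains 000.
¬0-word : ∀ W {r} m f → ¬ 𝟎 ∷ word m f ≡ quad W (𝟏 ∷ 𝟎 ∷ []) r
¬0-word W m f e with word m f | word-010 m f | Ok-sep-word β m f
¬0-word (𝟎 ∷ 𝟎 ∷ W) m f e | _ | _ , refl | ok = Ok-suffix (𝟎 ∷ 𝟎 ∷ W) (subst Ok e ok)
¬0-word (𝟎 ∷ []) m f () | _ | _ , refl | ok
¬0-word (𝟎 ∷ 𝟏 ∷ W) m f () | _ | _ , refl | ok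
¬0-word [] m f () | _ | _ , refl | ok
¬0-word (𝟏 ∷ W) m f () | _ | _ , refl | ok

¬101-word : ∀ o m f W {r} → ¬ sep o ++ word m f ≡ quad W (𝟏 ∷ 𝟎 ∷ 𝟏 ∷ []) (𝟎 ∷ r)
¬101-word α m f W {r} e with quad-word-φ [] [] W (𝟏 ∷ 𝟎 ∷ 𝟏 ∷ []) {𝟎 ∷ r} m f (sym e)
... | m′ , _ , e′ = ¬φ-quad-101 (sep (f 0) ++ word m′ (tl f)) W (Ok-sep-word (f 0) m′ (tl f)) e′
¬101-word β m f W {r} e with quad-word-φ [ 𝟏 ] [] W (𝟏 ∷ 𝟎 ∷ 𝟏 ∷ []) {𝟎 ∷ r} m f (sym e)
... | m′ , _ , e′ = ¬φ-quad-101 (𝟏 ∷ sep (f 0) ++ word m′ (tl f)) W (Ok-𝟏-sep-word (f 0) m′ (tl f)) e′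

word-010100 : ∀ o m f {r} → sep o ++ word m f ≡ 𝟎 ∷ 𝟏 ∷ 𝟎 ∷ 𝟏 ∷ 𝟎 ∷ 𝟎 ∷ r → o ≡ α × f 0 ≡ β
word-010100 α (suc m) f e with f 0 | word m (tl f) | word-010 m (tl f)
word-010100 α (suc m) f () | α | _ | r , refl
... | β | _ | r , refl = refl , refl
word-010100 β m f e with word m f | word-010 m f
word-010100 β m f () | _ | _ , refl

-- Simultaneous induction on the bound n for the period, which desubstitution shortens.
no-power : ∀ n f → ¬ Bad f → ∀ m p Y b {r} →
  p ++ quad Y [ b ] r ≡ word m f → length Y < n → ⊥
no-power-sep : ∀ n f → ¬ Bad f → ∀ m p Y b {r} →
  p ++ quad Y [ b ] r ≡ sep (f 0) ++ word m (tl f) → length Y < n → ⊥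
afterBeta : ∀ n f → ¬ Bad f → ∀ m Y b {r} →
  quad Y [ b ] r ≡ 𝟎 ∷ word m f → length Y < n → AfterBeta f
-- The period U01 has length |U| + 2, so this bound, like `length Y < n` for a period Yb, says that
-- the period is at most n.
afterBetas : ∀ n f → ¬ Bad f → ∀ m U {r} →
  quad U (𝟎 ∷ 𝟏 ∷ []) r ≡ 𝟎 ∷ word m f → suc (length U) < n → AfterBetas f
afterBeta-sep : ∀ n f → ¬ Bad f → ∀ m U {r} →
  quad U (𝟎 ∷ 𝟏 ∷ []) r ≡ sep (f 0) ++ word m (tl f) → suc (length U) < n → AfterBeta f
afterBetas-sep : ∀ n f → ¬ Bad f → ∀ m U {r} →
  quad U (𝟎 ∷ 𝟏 ∷ []) r ≡ sep (f 0) ++ word m (tl f) → suc (length U) < n → AfterBetas f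
-- An exact preimage would be a shorter 4⁻-power. The misread one is (W10)³W0; if the next operation
-- is α, a 0 put in front makes it a 4⁻-power of period 0W1, and β is impossible by `¬0-word`.
α-afterBeta : ∀ n f → ¬ Bad f → ∀ m V {r} →
  quad V (𝟎 ∷ 𝟏 ∷ []) r ≡ word m f → suc (length V) < n → f 0 ≡ α × AfterBeta (tl f)

no-power (suc n) f g m p Y b e (s≤s lt) with quad-word-φ [] p Y [ b ] m f e
... | m′ , r′ , e′ with φ-power⁻¹ (sep (f 0) ++ word m′ (tl f)) p Y b (Ok-sep-word (f 0) m′ (tl f)) e′
... | q , Z , b′ , s , eZ , ltZ = no-power-sep n f g m′ q Z b′ (sym eZ) (≤-trans ltZ lt)

no-power-sep n f g m p Y b e lt with f 0 in f0
no-power-sep n f g m p Y b e lt | α = no-power n (tl f) (g ∘ there) m p Y b e lt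
-- Only a power starting at the inserted 0 is new; any other lies in the word of the later
-- operations.
no-power-sep n f g m [] Y b e lt | β = g (here f0 (afterBeta n (tl f) (g ∘ there) m Y b e lt))
no-power-sep n f g m (_ ∷ p) Y b e lt | β = no-power n (tl f) (g ∘ there) m p Y b (∷-injectiveʳ e) lt

afterBeta n f g m [] b {r} e lt with b | subst Ok (sym e) (Ok-sep-word β m f)
... | 𝟎 | ()
... | 𝟏 | ()
afterBeta (suc n) f g m (𝟎 ∷ T) b e (s≤s lt) with quad-word-φ [ 𝟏 ] [] (𝟎 ∷ T) [ b ] m f e
... | m′ , r′ , e′ with φ-power⁻¹-𝟎 (𝟏 ∷ sep (f 0) ++ word m′ (tl f)) [] T b (Ok-𝟏-sep-word (f 0) m′ (tl f)) e′
... | 𝟎 ∷ _ , _ , _ , _ , _ , () , _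
... | 𝟏 ∷ _ , _ , _ , _ , _ , () , _
... | [] , [] , 𝟎 , s , () , _ , _
... | [] , 𝟎 ∷ _ , 𝟎 , s , () , _ , _
... | [] , 𝟎 ∷ _ , 𝟏 , s , () , _ , _
... | [] , [] , 𝟏 , s , eZ , _ , _ = ⊥-elim (subst Ok eZ (Ok-𝟏-sep-word (f 0) m′ (tl f)))
... | [] , 𝟏 ∷ U , 𝟏 , s , eZ , _ , _ = ⊥-elim (Ok-suffix (𝟏 ∷ U) (subst Ok eZ (Ok-𝟏-sep-word (f 0) m′ (tl f))))
-- Deleting the leading 1 rotates the period 1U0 to U01.
... | [] , 𝟏 ∷ U , 𝟎 , s , eZ , _ , ltZ
  = afterBeta-sep n f g m′ U (sym (∷-injectiveʳ eZ)) (≤-trans ltZ lt)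

afterBeta-sep n f g m U e lt with f 0 in f0
... | α = α? f0 (proj₂ (α-afterBeta n (tl f) (g ∘ there) m U e lt))
... | β = β+ f0 (afterBetas n (tl f) (g ∘ there) m U e lt)

α-afterBeta n f g m V e lt with quad-word-φ [] [] V (𝟎 ∷ 𝟏 ∷ []) m f e
... | m′ , r′ , e′ with φ-quad⁻¹ (sep (f 0) ++ word m′ (tl f)) V 𝟎 [] e′
       (NotOne-quad-01 V _ _ (Ok-φ (sep (f 0) ++ word m′ (tl f)) (Ok-sep-word (f 0) m′ (tl f)))
         (NotOne-φ (sep (f 0) ++ word m′ (tl f)) refl) e′)
... | P , refl , inj₁ (t , eP , _) =
  ⊥-elim (no-power-sep n f g m′ [] P 𝟎 (sym eP)
    (≤-trans (s≤s (≤-trans (length≤length-φ P) (n≤1+n _))) lt))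
... | _ , refl , inj₂ (W , t , refl , eW , _) with f 0
... | α = refl , afterBeta n (tl f) (g ∘ there) m′ (𝟎 ∷ W) 𝟏
    (trans (sym (quad-misread W (𝟎 ∷ t))) (cong (𝟎 ∷_) (sym eW)))
    (≤-trans (s≤s (≤-trans (≤-reflexive (sym (length-∷ʳ W 𝟏))) (≤-trans (length≤length-φ (W ∷ʳ 𝟏)) (n≤1+n _)))) lt)
... | β = ⊥-elim (¬0-word W m′ (tl f) eW)

afterBetas (suc n) f g m U e (s≤s lt) with quad-word-φ [ 𝟏 ] [] U (𝟎 ∷ 𝟏 ∷ []) m f e
... | m′ , r′ , e′ with φ-quad⁻¹ (𝟏 ∷ sep (f 0) ++ word m′ (tl f)) U 𝟎 [] e′
       (NotOne-quad-01 U _ _ (Ok-φ (𝟏 ∷ sep (f 0) ++ word m′ (tl f)) (Ok-𝟏-sep-word (f 0) m′ (tl f))) tt e′)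
... | [] , refl , inj₁ (t , () , _)
... | 𝟎 ∷ _ , refl , inj₁ (t , () , _)
... | 𝟏 ∷ V , refl , inj₁ (t , eV , _)
    = afterBetas-sep n f g m′ V (sym (∷-injectiveʳ eV)) (≤-trans (s≤s (s≤s (length≤length-φ V))) lt)
afterBetas (suc n) f g m U e (s≤s lt) | m′ , r′ , e′
  | _ , refl , inj₂ (𝟎 ∷ W , t , refl , () , _)
-- Deleting the leading 1 of (1W10)³1W0 rotates the period to W101.
afterBetas (suc n) f g m U e (s≤s lt) | m′ , r′ , e′
  | _ , refl , inj₂ (𝟏 ∷ W , t , refl , eW , _) = ⊥-elim (¬101-word (f 0) m′ (tl f) W (∷-injectiveʳ eW))
-- The run stops: U = 0, and the preimage 1010100 leaves 010100 after its leading 1.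
afterBetas (suc n) f g m U e (s≤s lt) | m′ , r′ , e′
  | _ , refl , inj₂ ([] , t , refl , eW , _)
  with f0 , f1 ← word-010100 (f 0) m′ (tl f) (∷-injectiveʳ eW) = αβ f0 f1

afterBetas-sep n f g m V e lt with f 0 in f0
... | β = β+ f0 (afterBetas n (tl f) (g ∘ there) m V e lt)
... | α with α-afterBeta n (tl f) (g ∘ there) m V e lt
... | f1 , A = αα f0 f1 A

-- From a bad run to a 4⁻-power.

word-grows : ∀ m f → ∃₂ λ a r → word (suc m) f ≡ word m f ++ a ∷ r
word-grows zero f with f 0
... | α = _ , _ , refl
... | β = _ , _ , refl
word-grows (suc m) f with word-grows m (tl f)
... | a , r , eq = φ-∷ a (begin
  φ (sep (f 0) ++ word (suc m) (tl f))          ≡⟨ cong (λ w → φ (sep (f 0) ++ w)) eq ⟩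
  φ (sep (f 0) ++ word m (tl f) ++ a ∷ r)       ≡⟨ cong φ (++-assoc (sep (f 0)) _ (a ∷ r)) ⟨
  φ ((sep (f 0) ++ word m (tl f)) ++ a ∷ r)     ≡⟨ φ-++ (sep (f 0) ++ word m (tl f)) (a ∷ r) ⟩
  word (suc m) f ++ φ (a ∷ r)                   ∎)
  where
  open ≡-Reasoning
  φ-∷ : ∀ {w u} a {r} → w ≡ u ++ φ (a ∷ r) → ∃₂ λ b t → w ≡ u ++ b ∷ t
  φ-∷ 𝟎 e = _ , _ , e
  φ-∷ 𝟏 e = _ , _ , e

++-∷ : ∀ (u : List Bit) a r → ∃₂ λ b t → u ++ a ∷ r ≡ b ∷ t
++-∷ []      a r = a , r , refl
++-∷ (b ∷ u) a r = b , u ++ a ∷ r , refl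

-- A power may end where `word m f` ends; one more operation supplies the letter after it that its
-- image under φ needs.
quad-word-extend : ∀ c p V s {r} m f → p ++ quad V s r ≡ c ++ word m f →
  ∃₂ λ a r′ → p ++ quad V s (a ∷ r′) ≡ c ++ word (suc m) f
quad-word-extend c p V s {r} m f e with word-grows m f
... | a , r₁ , e₁ with ++-∷ r a r₁
... | b , t , e₂ = b , t , (begin
  p ++ quad V s (b ∷ t)           ≡⟨ cong (λ r → p ++ quad V s r) e₂ ⟨
  p ++ quad V s (r ++ a ∷ r₁)     ≡⟨ cong (p ++_) (quad-++ V s r _) ⟨
  p ++ quad V s r ++ a ∷ r₁       ≡⟨ ++-assoc p _ _ ⟨
  (p ++ quad V s r) ++ a ∷ r₁     ≡⟨ cong (_++ a ∷ r₁) e ⟩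
  (c ++ word m f) ++ a ∷ r₁       ≡⟨ ++-assoc c _ _ ⟩
  c ++ word m f ++ a ∷ r₁         ≡⟨ cong (c ++_) e₁ ⟨
  c ++ word (suc m) f             ∎)
  where open ≡-Reasoning

φ-∷≡𝟎∷ : ∀ a r → ∃ λ t → φ (a ∷ r) ≡ 𝟎 ∷ t
φ-∷≡𝟎∷ 𝟎 r = _ , refl
φ-∷≡𝟎∷ 𝟏 r = _ , refl

-- For b = 0 the image of the period ends in 01, so the last copy must gain a 0 to be a period
-- without its last letter; φ(a) starts with it.
φ-power : ∀ p Y b a r → ∃ λ Y′ → ∃ λ b′ → ∃ λ r′ →
  φ (p ++ quad Y [ b ] (a ∷ r)) ≡ φ p ++ quad Y′ [ b′ ] r′
φ-power p Y 𝟏 a r = φ Y , 𝟎 , _ , trans (φ-++ p _) (cong (φ p ++_) (φ-quad Y [ 𝟏 ] (a ∷ r)))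
φ-power p Y 𝟎 a r with φ-∷≡𝟎∷ a r
... | t , e = φ Y ∷ʳ 𝟎 , 𝟏 , t , (begin
  φ (p ++ quad Y [ 𝟎 ] (a ∷ r))                      ≡⟨ φ-++ p _ ⟩
  φ p ++ φ (quad Y [ 𝟎 ] (a ∷ r))                    ≡⟨ cong (φ p ++_) (φ-quad Y [ 𝟎 ] (a ∷ r)) ⟩
  φ p ++ quad (φ Y) (𝟎 ∷ 𝟏 ∷ []) (φ (a ∷ r))         ≡⟨ cong (λ r → φ p ++ quad (φ Y) (𝟎 ∷ 𝟏 ∷ []) r) e ⟩
  φ p ++ quad (φ Y) (𝟎 ∷ 𝟏 ∷ []) (𝟎 ∷ t)             ≡⟨ cong (φ p ++_) (quad-shiftʳ (φ Y) [ 𝟎 ] [ 𝟏 ] t) ⟨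
  φ p ++ quad (φ Y ∷ʳ 𝟎) [ 𝟏 ] t                     ∎)
  where open ≡-Reasoning

HasPower : Word∞ Op → Set
HasPower f = ∃ λ m → ∃ λ p → ∃ λ Y → ∃ λ b → ∃ λ r → p ++ quad Y [ b ] r ≡ word m f

PowerAfter𝟎 : Word∞ Op → Set
PowerAfter𝟎 f = ∃ λ m → ∃ λ Y → ∃ λ b → ∃ λ r → quad Y [ b ] r ≡ 𝟎 ∷ word m f

-- With c = 0 the prefix is a 4⁻-power of period U01; with c empty it may be one letter short of
-- that.
CubeAfter𝟎 : List Bit → Word∞ Op → Set
CubeAfter𝟎 c f = ∃ λ m → ∃ λ U → ∃ λ r → quad U (𝟎 ∷ 𝟏 ∷ []) (c ++ r) ≡ 𝟎 ∷ word m f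

HasPower-φ : ∀ f m p Y b {r} → p ++ quad Y [ b ] r ≡ sep (f 0) ++ word m (tl f) → HasPower f
HasPower-φ f m p Y b e with quad-word-extend (sep (f 0)) p Y [ b ] m (tl f) e
... | a , r , e₁ with φ-power p Y b a r
... | Y′ , b′ , r′ , e₂ = suc (suc m) , φ p , Y′ , b′ , r′ , trans (sym e₂) (cong φ e₁)

HasPower-tl : ∀ f → HasPower (tl f) → HasPower f
HasPower-tl f (m , p , Y , b , r , e) =
  HasPower-φ f m (sep (f 0) ++ p) Y b (trans (++-assoc (sep (f 0)) p _) (cong (sep (f 0) ++_) e))

HasPower-β : ∀ f → f 0 ≡ β → PowerAfter𝟎 (tl f) → HasPower f
HasPower-β f f0 (m , Y , b , r , e) =
  HasPower-φ f m [] Y b (trans e (cong (λ o → sep o ++ word m (tl f)) (sym f0)))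

-- The image period φ(U)010 is rotated to 0φ(U)01 by the 0 in front, and the next block starts with
-- the required 0.
CubeAfter𝟎-φ : ∀ f m U {r} → quad U (𝟎 ∷ 𝟏 ∷ []) r ≡ sep (f 0) ++ word m (tl f) → CubeAfter𝟎 [ 𝟎 ] f
CubeAfter𝟎-φ f m U e with quad-word-extend (sep (f 0)) [] U (𝟎 ∷ 𝟏 ∷ []) m (tl f) e
... | a , r , e₁ with φ-∷≡𝟎∷ a r
... | t , e₂ = suc (suc m) , 𝟎 ∷ φ U , t , (begin
  quad (𝟎 ∷ φ U) (𝟎 ∷ 𝟏 ∷ []) (𝟎 ∷ t)          ≡⟨ cong (quad (𝟎 ∷ φ U) (𝟎 ∷ 𝟏 ∷ [])) e₂ ⟨
  quad (𝟎 ∷ φ U) (𝟎 ∷ 𝟏 ∷ []) (φ (a ∷ r))      ≡⟨ quad-shiftˡ [ 𝟎 ] (φ U) (𝟎 ∷ 𝟏 ∷ []) _ ⟨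
  𝟎 ∷ quad (φ U) (𝟎 ∷ 𝟏 ∷ 𝟎 ∷ []) (φ (a ∷ r))  ≡⟨ cong (𝟎 ∷_) (φ-quad U (𝟎 ∷ 𝟏 ∷ []) (a ∷ r)) ⟨
  𝟎 ∷ φ (quad U (𝟎 ∷ 𝟏 ∷ []) (a ∷ r))          ≡⟨ cong (λ w → 𝟎 ∷ φ w) e₁ ⟩
  𝟎 ∷ word (suc (suc m)) f                     ∎)
  where open ≡-Reasoning

CubeAfter𝟎-β : ∀ f → f 0 ≡ β → CubeAfter𝟎 [] (tl f) → CubeAfter𝟎 [ 𝟎 ] f
CubeAfter𝟎-β f f0 (m , U , r , e) =
  CubeAfter𝟎-φ f m U (trans e (cong (λ o → sep o ++ word m (tl f)) (sym f0)))

CubeAfter𝟎-forget : ∀ f → CubeAfter𝟎 [ 𝟎 ] f → CubeAfter𝟎 [] f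
CubeAfter𝟎-forget f (m , U , r , e) = m , U , 𝟎 ∷ r , e

Cube⇒PowerAfter𝟎 : ∀ f → CubeAfter𝟎 [ 𝟎 ] f → PowerAfter𝟎 f
Cube⇒PowerAfter𝟎 f (m , U , r , e) = m , U ∷ʳ 𝟎 , 𝟏 , r , trans (quad-shiftʳ U [ 𝟎 ] [ 𝟏 ] r) e

PowerAfter𝟎-shape : ∀ m f Y b {r} → quad Y [ b ] r ≡ 𝟎 ∷ word m f → ∃ λ W → Y ≡ 𝟎 ∷ W × b ≡ 𝟏
PowerAfter𝟎-shape m f Y b e with word m f | word-010 m f | Ok-sep-word β m f
PowerAfter𝟎-shape m f []          𝟎 () | _ | r , refl | ok
PowerAfter𝟎-shape m f []          𝟏 () | _ | r , refl | ok
PowerAfter𝟎-shape m f (𝟎 ∷ W)     𝟏 e | _ | r , refl | ok = W , refl , refl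
PowerAfter𝟎-shape m f (𝟎 ∷ [])    𝟎 () | _ | r , refl | ok
PowerAfter𝟎-shape m f (𝟎 ∷ 𝟏 ∷ W) 𝟎 () | _ | r , refl | ok
PowerAfter𝟎-shape m f (𝟎 ∷ 𝟎 ∷ W) 𝟎 e | _ | r , refl | ok = ⊥-elim (Ok-suffix (𝟎 ∷ 𝟎 ∷ W) (subst Ok (sym e) ok))

-- The misreading in reverse: without its first 0 the power is (W10)³W. The second α, with the first
-- 0 of the following block, turns it into (φ(W)001)³φ(W)0, which is (U01)³U for U = φ(W)0; the
-- first α is `CubeAfter𝟎-φ`.
αα-CubeAfter𝟎 : ∀ f → f 0 ≡ α → f 1 ≡ α → PowerAfter𝟎 (tl (tl f)) → CubeAfter𝟎 [ 𝟎 ] f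
αα-CubeAfter𝟎 f f0 f1 (m , Y , b , r , e) with PowerAfter𝟎-shape m (tl (tl f)) Y b e
... | W , refl , refl
  with quad-word-extend [] [] W (𝟏 ∷ 𝟎 ∷ []) m (tl (tl f)) (∷-injectiveʳ (trans (quad-misread W r) e))
... | a , r′ , e₁ with φ-∷≡𝟎∷ a r′
... | t , e₂ = CubeAfter𝟎-φ f (suc (suc m)) (φ W ∷ʳ 𝟎) (begin
  quad (φ W ∷ʳ 𝟎) (𝟎 ∷ 𝟏 ∷ []) t                       ≡⟨ quad-shiftʳ (φ W) [ 𝟎 ] (𝟎 ∷ 𝟏 ∷ []) t ⟩
  quad (φ W) (𝟎 ∷ 𝟎 ∷ 𝟏 ∷ []) (𝟎 ∷ t)                  ≡⟨ cong (quad (φ W) (𝟎 ∷ 𝟎 ∷ 𝟏 ∷ [])) e₂ ⟨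
  quad (φ W) (𝟎 ∷ 𝟎 ∷ 𝟏 ∷ []) (φ (a ∷ r′))             ≡⟨ φ-quad W (𝟏 ∷ 𝟎 ∷ []) (a ∷ r′) ⟨
  φ (quad W (𝟏 ∷ 𝟎 ∷ []) (a ∷ r′))                     ≡⟨ cong φ e₁ ⟩
  φ (word (suc m) (tl (tl f)))                         ≡⟨ cong (λ o → φ (sep o ++ word (suc m) (tl (tl f)))) f1 ⟨
  word (suc (suc m)) (tl f)                            ≡⟨ cong (λ o → sep o ++ word (suc (suc m)) (tl f)) f0 ⟨
  sep (f 0) ++ word (suc (suc m)) (tl f)               ∎)
  where open ≡-Reasoning

AfterBeta⇒Power  : ∀ f → AfterBeta f  → HasPower f ⊎ PowerAfter𝟎 f
AfterBetas⇒Power : ∀ f → AfterBetas f → HasPower f ⊎ CubeAfter𝟎 [] f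

AfterBeta⇒Power f (β+ f0 A) with AfterBetas⇒Power (tl f) A
... | inj₁ h = inj₁ (HasPower-tl f h)
... | inj₂ c = inj₂ (Cube⇒PowerAfter𝟎 f (CubeAfter𝟎-β f f0 c))
AfterBeta⇒Power f (α? f0 A) with AfterBeta⇒Power (tl (tl f)) A | f 1 in f1
... | inj₁ h | _ = inj₁ (HasPower-tl f (HasPower-tl (tl f) h))
... | inj₂ q | α = inj₂ (Cube⇒PowerAfter𝟎 f (αα-CubeAfter𝟎 f f0 f1 q))
-- The second operation, β, itself puts the 0 in front of the word.
... | inj₂ q | β = inj₁ (HasPower-tl f (HasPower-β (tl f) f1 q))

AfterBetas⇒Power f (β+ f0 A) with AfterBetas⇒Power (tl f) A
... | inj₁ h = inj₁ (HasPower-tl f h)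
... | inj₂ c = inj₂ (CubeAfter𝟎-forget f (CubeAfter𝟎-β f f0 c))
AfterBetas⇒Power f (αα f0 f1 A) with AfterBeta⇒Power (tl (tl f)) A
... | inj₁ h = inj₁ (HasPower-tl f (HasPower-tl (tl f) h))
... | inj₂ q = inj₂ (CubeAfter𝟎-forget f (αα-CubeAfter𝟎 f f0 f1 q))
-- 0φ(φ(0010)) = (001)³0·10. The next letter is 1, so this is not yet a 4⁻-power of period 001; the
-- β before it leads to one.
AfterBetas⇒Power f (αβ f0 f1) = inj₂ (2 , [ 𝟎 ] , 𝟏 ∷ 𝟎 ∷ [] , cong (𝟎 ∷_) (sym (begin
  φ (sep (f 0) ++ φ (sep (f 1) ++ 𝟎 ∷ 𝟏 ∷ 𝟎 ∷ []))   ≡⟨ cong (λ o → φ (sep o ++ φ (sep (f 1) ++ 𝟎 ∷ 𝟏 ∷ 𝟎 ∷ []))) f0 ⟩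
  φ (φ (sep (f 1) ++ 𝟎 ∷ 𝟏 ∷ 𝟎 ∷ []))                ≡⟨ cong (λ o → φ (φ (sep o ++ 𝟎 ∷ 𝟏 ∷ 𝟎 ∷ []))) f1 ⟩
  φ (φ (𝟎 ∷ 𝟎 ∷ 𝟏 ∷ 𝟎 ∷ []))                         ∎)))
  where open ≡-Reasoning

Bad⇒HasPower : ∀ f → Bad f → HasPower f
Bad⇒HasPower f (there b) = HasPower-tl f (Bad⇒HasPower (tl f) b)
Bad⇒HasPower f (here f0 A) with AfterBeta⇒Power (tl f) A
... | inj₁ h = HasPower-tl f h
... | inj₂ q = HasPower-β f f0 q

-- Prefixes and factors of infinite words.

Begins : {A : Set} → List A → Word∞ A → Set
Begins []      x = ⊤
Begins (a ∷ w) x = x 0 ≡ a × Begins w (tl x)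

segment-tl : {A : Set} (x : Word∞ A) → ∀ i n → segment x (suc i) n ≡ segment (tl x) i n
segment-tl x i zero    = refl
segment-tl x i (suc n) = cong (x (suc i) ∷_) (segment-tl x (suc i) n)

IsPrefix⇒Begins : {A : Set} (w : List A) (x : Word∞ A) → IsPrefix w x → Begins w x
IsPrefix⇒Begins []      x e = tt
IsPrefix⇒Begins (a ∷ w) x e =
  ∷-injectiveˡ e , IsPrefix⇒Begins w (tl x) (trans (sym (segment-tl x 0 (length w))) (∷-injectiveʳ e))

Begins⇒IsPrefix : {A : Set} (w : List A) (x : Word∞ A) → Begins w x → IsPrefix w x
Begins⇒IsPrefix []      x b       = refl
Begins⇒IsPrefix (a ∷ w) x (e , b) =
  trans (cong (_∷ segment x 1 (length w)) e)
        (cong (a ∷_) (trans (segment-tl x 0 (length w)) (Begins⇒IsPrefix w (tl x) b)))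

Begins-segment : {A : Set} (x : Word∞ A) → ∀ n → Begins (segment x 0 n) x
Begins-segment x zero    = tt
Begins-segment x (suc n) = refl , subst (λ w → Begins w (tl x)) (sym (segment-tl x 0 n)) (Begins-segment (tl x) n)

Begins-++ : {A : Set} (u v : List A) (x : Word∞ A) → Begins (u ++ v) x → Begins u x
Begins-++ []      v x b       = tt
Begins-++ (a ∷ u) v x (e , b) = e , Begins-++ u v (tl x) b

Begins-extend : {A : Set} (u : List A) (x : Word∞ A) → Begins u x → ∃ λ a → Begins (u ++ [ a ]) x
Begins-extend []      x b = x 0 , refl , tt
Begins-extend (a ∷ u) x (e , b) with Begins-extend u (tl x) b
... | c , b′ = c , e , b′

Begins-prefix : {A : Set} (u v : List A) (x : Word∞ A) → Begins u x → Begins v x →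
  length u ≤ length v → ∃ λ r → u ++ r ≡ v
Begins-prefix []      v       x bu        bv        le = v , refl
Begins-prefix (a ∷ u) (c ∷ v) x (ea , bu) (ec , bv) (s≤s le) with Begins-prefix u v (tl x) bu bv le
... | r , e = r , trans (cong (_∷ u ++ r) (trans (sym ea) ec)) (cong (c ∷_) e)

Contains : {A : Set} → (List A → Set) → Word∞ A → Set
Contains P x = ∃₂ λ p u → P u × Begins (p ++ u) x

HasFactor⇒Contains : {A : Set} (P : List A → Set) (x : Word∞ A) → HasFactor P x → Contains P x
HasFactor⇒Contains P x (i , n , q) = go i x q
  where
  go : ∀ i x → P (segment x i n) → Contains P x
  go zero    x q = [] , _ , q , Begins-segment x n
  go (suc i) x q with go i (tl x) (subst P (segment-tl x i n) q)
  ... | p , u , q′ , b = x 0 ∷ p , u , q′ , refl , b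

HasFactor-tl : {A : Set} (P : List A → Set) (x : Word∞ A) → HasFactor P (tl x) → HasFactor P x
HasFactor-tl P x (i , n , q) = suc i , n , subst P (sym (segment-tl x i n)) q

Contains⇒HasFactor : {A : Set} (P : List A → Set) (x : Word∞ A) → Contains P x → HasFactor P x
Contains⇒HasFactor P x (p , u , q , b) = go p x b
  where
  go : ∀ p x → Begins (p ++ u) x → HasFactor P x
  go []      x b       = 0 , length u , subst P (sym (Begins⇒IsPrefix u x b)) q
  go (_ ∷ p) x (_ , b) = HasFactor-tl P x (go p (tl x) b)

-- The automaton against the regular expression F.

Begins-β⋆αβ : ∀ k f → Begins (replicate k β ++ α ∷ β ∷ []) f → AfterBetas f
Begins-β⋆αβ zero    f (f0 , f1 , _) = αβ f0 f1
Begins-β⋆αβ (suc k) f (f0 , b)      = β+ f0 (Begins-β⋆αβ k (tl f) b)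

Blocks⇒AfterBeta : ∀ {u v} → Blocks u → Tail v → ∀ f → Begins (u ++ v) f → AfterBeta f
β⋆αα⇒AfterBetas : ∀ {u v} → Blocks u → Tail v → ∀ k f →
  Begins (((replicate k β ++ α ∷ α ∷ []) ++ u) ++ v) f → AfterBetas f

Blocks⇒AfterBeta [] βαβ      f (f0 , f1 , f2 , _) = β+ f0 (αβ f1 f2)
Blocks⇒AfterBeta [] (ββαβ k) f (f0 , f1 , b)      = β+ f0 (β+ f1 (Begins-β⋆αβ k (tl (tl f)) b))
Blocks⇒AfterBeta (αα ∷ B)     T f (f0 , f1 , b)   = α? f0 (Blocks⇒AfterBeta B T (tl (tl f)) b)
Blocks⇒AfterBeta (αβ ∷ B)     T f (f0 , f1 , b)   = α? f0 (Blocks⇒AfterBeta B T (tl (tl f)) b)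
Blocks⇒AfterBeta (βαα ∷ B)    T f (f0 , f1 , f2 , b) =
  β+ f0 (αα f1 f2 (Blocks⇒AfterBeta B T (tl (tl (tl f))) b))
Blocks⇒AfterBeta (ββαα k ∷ B) T f (f0 , f1 , b)   = β+ f0 (β+ f1 (β⋆αα⇒AfterBetas B T k (tl (tl f)) b))

β⋆αα⇒AfterBetas B T zero    f (f0 , f1 , b) = αα f0 f1 (Blocks⇒AfterBeta B T (tl (tl f)) b)
β⋆αα⇒AfterBetas B T (suc k) f (f0 , b)      = β+ f0 (β⋆αα⇒AfterBetas B T k (tl f) b)

HasFactor-F⇒Bad : ∀ f → HasFactor InF f → Bad f
HasFactor-F⇒Bad f h with HasFactor⇒Contains InF f h
... | p , _ , (i , u , v , B , T , refl) , b = skip p f b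
  where
  αs : ∀ i f → Begins (replicate i α ++ β ∷ u ++ v) f → Bad f
  αs zero    f (f0 , b) = here f0 (Blocks⇒AfterBeta B T (tl f) b)
  αs (suc i) f (_ , b)  = there (αs i (tl f) b)
  skip : ∀ p f → Begins (p ++ replicate i α ++ β ∷ u ++ v) f → Bad f
  skip []      f b       = αs i f b
  skip (_ ∷ p) f (_ , b) = there (skip p (tl f) b)

BlocksTail : List Op → Set
BlocksTail w = ∃₂ λ u v → Blocks u × Tail v × w ≡ u ++ v

AfterBeta⇒Blocks : ∀ f → AfterBeta f → ∃ λ w → BlocksTail w × Begins w f
AfterBetas⇒Blocks : ∀ f → AfterBetas f → ∃ λ k →
  Begins (replicate k β ++ α ∷ β ∷ []) f ⊎
  (∃ λ w → BlocksTail w × Begins (replicate k β ++ α ∷ α ∷ w) f)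

AfterBeta⇒Blocks f (α? f0 A) with AfterBeta⇒Blocks (tl (tl f)) A | f 1 in f1
... | _ , (u , v , B , T , refl) , b | α = _ , (_ , v , αα ∷ B , T , refl) , f0 , f1 , b
... | _ , (u , v , B , T , refl) , b | β = _ , (_ , v , αβ ∷ B , T , refl) , f0 , f1 , b
AfterBeta⇒Blocks f (β+ f0 A) with AfterBetas⇒Blocks (tl f) A
... | zero  , inj₁ b = _ , ([] , _ , [] , βαβ , refl) , f0 , b
... | suc k , inj₁ b = _ , ([] , _ , [] , ββαβ k , refl) , f0 , b
... | zero  , inj₂ (_ , (u , v , B , T , refl) , b) = _ , (_ , v , βαα ∷ B , T , refl) , f0 , b
... | suc k , inj₂ (_ , (u , v , B , T , refl) , b) =
      _ , (_ , v , ββαα k ∷ B , T , cong (λ w → β ∷ β ∷ w) (reassoc (replicate k β) (α ∷ α ∷ []) u v)) , f0 , b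
  where
  reassoc : ∀ (s t u v : List Op) → s ++ t ++ u ++ v ≡ ((s ++ t) ++ u) ++ v
  reassoc s t u v = solve (++-monoid Op)

AfterBetas⇒Blocks f (αβ f0 f1)   = 0 , inj₁ (f0 , f1 , tt)
AfterBetas⇒Blocks f (αα f0 f1 A) with AfterBeta⇒Blocks (tl (tl f)) A
... | w , bt , b = 0 , inj₂ (w , bt , f0 , f1 , b)
AfterBetas⇒Blocks f (β+ f0 A) with AfterBetas⇒Blocks (tl f) A
... | k , inj₁ b            = suc k , inj₁ (f0 , b)
... | k , inj₂ (w , bt , b) = suc k , inj₂ (w , bt , f0 , b)

Bad⇒HasFactor-F : ∀ f → Bad f → HasFactor InF f
Bad⇒HasFactor-F f (there b) = HasFactor-tl InF f (Bad⇒HasFactor-F (tl f) b)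
Bad⇒HasFactor-F f (here f0 A) with AfterBeta⇒Blocks (tl f) A
... | _ , (u , v , B , T , refl) , b =
      Contains⇒HasFactor InF f ([] , β ∷ u ++ v , (0 , u , v , B , T , refl) , f0 , b)

-- 4⁻-powers in the form `quad`.

dropLast-∷ʳ : ∀ {A : Set} (Y : List A) b → dropLast (Y ∷ʳ b) ≡ Y
dropLast-∷ʳ []          b = refl
dropLast-∷ʳ (a ∷ [])    b = refl
dropLast-∷ʳ (a ∷ c ∷ Y) b = cong (a ∷_) (dropLast-∷ʳ (c ∷ Y) b)

4⁻≡quad : ∀ Y b → (Y ∷ʳ b) ++ (Y ∷ʳ b) ++ (Y ∷ʳ b) ++ dropLast (Y ∷ʳ b) ≡ quad Y [ b ] []
4⁻≡quad Y b = trans (cong (λ d → X ++ X ++ X ++ d) (dropLast-∷ʳ Y b)) (reassoc Y [ b ])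
  where
  X = Y ∷ʳ b
  reassoc : ∀ Y c → (Y ++ c) ++ (Y ++ c) ++ (Y ++ c) ++ Y ≡ quad Y c []
  reassoc Y c = solve (++-monoid Bit)

FourMinusPower⇒quad : ∀ {w} → FourMinusPower w → ∃₂ λ Y b → w ≡ quad Y [ b ] []
FourMinusPower⇒quad (a , t , e) with unsnoc a t
... | Y , b , eX = Y , b , trans e (trans (cong (λ X → X ++ X ++ X ++ dropLast X) eX) (4⁻≡quad Y b))

quad⇒FourMinusPower : ∀ Y b → FourMinusPower (quad Y [ b ] [])
quad⇒FourMinusPower []      b = b , [] , sym (4⁻≡quad [] b)
quad⇒FourMinusPower (a ∷ Y) b = a , Y ∷ʳ b , sym (4⁻≡quad (a ∷ Y) b)

No11 NoPower : Word∞ Bit → Set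
No11 x    = ∀ p → ¬ Begins (p ++ 𝟏 ∷ 𝟏 ∷ []) x
NoPower x = ∀ p Y b → ¬ Begins (p ++ quad Y [ b ] []) x

FauxBonacci⇒ : ∀ x → FauxBonacci x → No11 x × NoPower x
FauxBonacci⇒ x (n11 , npow) =
  (λ p b → n11 (Contains⇒HasFactor Is11 x (p , _ , refl , b))) ,
  (λ p Y c b → npow (Contains⇒HasFactor FourMinusPower x (p , _ , quad⇒FourMinusPower Y c , b)))

⇒FauxBonacci : ∀ x → No11 x → NoPower x → FauxBonacci x
⇒FauxBonacci x n11 npow = no11 , nopow
  where
  no11 : ¬ HasFactor Is11 x
  no11 h with HasFactor⇒Contains Is11 x h
  ... | p , _ , refl , b = n11 p b
  nopow : ¬ HasFactor FourMinusPower x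
  nopow h with HasFactor⇒Contains FourMinusPower x h
  ... | p , _ , F , b with FourMinusPower⇒quad F
  ... | Y , c , refl = npow p Y c b

-- Agreement of `word` with the Fibonacci-word definition of the bullet.

φ^ : ℕ → List Bit → List Bit
φ^ zero    u = u
φ^ (suc m) u = φ^ m (φ u)

φ^-++ : ∀ m u v → φ^ m (u ++ v) ≡ φ^ m u ++ φ^ m v
φ^-++ zero    u v = refl
φ^-++ (suc m) u v = trans (cong (φ^ m) (φ-++ u v)) (φ^-++ m (φ u) (φ v))

φ^-0  : ∀ m → φ^ m [ 𝟎 ] ≡ fib m
φ^-01 : ∀ m → φ^ m (𝟎 ∷ 𝟏 ∷ []) ≡ fib (suc m)
φ^-010 : ∀ m → φ^ m (𝟎 ∷ 𝟏 ∷ 𝟎 ∷ []) ≡ fib (suc (suc m))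

φ^-0 zero     = refl
φ^-0 (suc m)  = φ^-01 m
φ^-01 zero    = refl
φ^-01 (suc m) = φ^-010 m
φ^-010 m = begin
  φ^ m (𝟎 ∷ 𝟏 ∷ 𝟎 ∷ [])            ≡⟨ φ^-++ m (𝟎 ∷ 𝟏 ∷ []) [ 𝟎 ] ⟩
  φ^ m (𝟎 ∷ 𝟏 ∷ []) ++ φ^ m [ 𝟎 ]  ≡⟨ cong (_++ φ^ m [ 𝟎 ]) (φ^-01 m) ⟩
  fib (suc m) ++ φ^ m [ 𝟎 ]        ≡⟨ cong (fib (suc m) ++_) (φ^-0 m) ⟩
  fib (suc m) ++ fib m             ∎
  where open ≡-Reasoning

expand-last : ∀ u m f → expand u (suc m) f ≡ expand (φ (sep (f m) ++ u)) m f
expand-last u zero    f = refl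
expand-last u (suc m) f = cong (λ w → φ (sep (f 0) ++ w)) (expand-last u m (tl f))

-- The last operation acts innermost: a β with index m contributes φ^m(φ(0)) = φ^m(01) = F_{m+1},
-- the word that `yPart` appends.
expand≡yPart : ∀ u m f → expand u m f ≡ yPart [] f m ++ φ^ m u
expand≡yPart u zero    f = refl
expand≡yPart u (suc m) f with e ← trans (expand-last u m f) (expand≡yPart (φ (sep (f m) ++ u)) m f) | f m
... | α = e
... | β = trans e (begin
  yPart [] f m ++ φ^ m (𝟎 ∷ 𝟏 ∷ φ u)                ≡⟨ cong (yPart [] f m ++_) (φ^-++ m (𝟎 ∷ 𝟏 ∷ []) (φ u)) ⟩
  yPart [] f m ++ φ^ m (𝟎 ∷ 𝟏 ∷ []) ++ φ^ m (φ u)   ≡⟨ cong (λ w → yPart [] f m ++ w ++ φ^ m (φ u)) (φ^-01 m) ⟩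
  yPart [] f m ++ fib (suc m) ++ φ^ m (φ u)         ≡⟨ ++-assoc (yPart [] f m) _ _ ⟨
  (yPart [] f m ++ fib (suc m)) ++ φ^ m (φ u)       ∎)
  where open ≡-Reasoning

bulletFin≡word : ∀ m f → bulletFin [] f m ≡ word m f
bulletFin≡word m f = sym (trans (expand≡yPart (𝟎 ∷ 𝟏 ∷ 𝟎 ∷ []) m f) (cong (yPart [] f m ++_) (φ^-010 m)))

-- Reading the operations off a faux-bonacci word.

decodeBit : Bit → Bit
decodeBit 𝟎 = 𝟏
decodeBit 𝟏 = 𝟎

afterBlock : Word∞ Bit → Word∞ Bit
afterBlock x with x 1
... | 𝟎 = tl x
... | 𝟏 = tl (tl x)

-- The preimage under φ of a word without factor 11 that starts with 0.
decode : Word∞ Bit → Word∞ Bit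
decode x zero    = decodeBit (x 1)
decode x (suc n) = decode (afterBlock x) n

No11-tl : ∀ x → No11 x → No11 (tl x)
No11-tl x n p b = n (x 0 ∷ p) (refl , b)

afterBlock-0 : ∀ x → No11 x → afterBlock x 0 ≡ 𝟎
afterBlock-0 x n with x 1 in x1
... | 𝟎 = x1
... | 𝟏 with x 2 in x2
...   | 𝟎 = refl
...   | 𝟏 = ⊥-elim (n [ x 0 ] (refl , x1 , x2 , tt))

No11-afterBlock : ∀ x → No11 x → No11 (afterBlock x)
No11-afterBlock x n with x 1
... | 𝟎 = No11-tl x n
... | 𝟏 = No11-tl (tl x) (No11-tl x n)

Begins-decode : ∀ u x → No11 x → x 0 ≡ 𝟎 → Begins u (decode x) → Begins (φ u) x
Begins-decode []      x n x0 b = tt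
Begins-decode (a ∷ u) x n x0 (e , b)
  with ih ← Begins-decode u (afterBlock x) (No11-afterBlock x n) (afterBlock-0 x n) b | x 1 in x1
Begins-decode (𝟎 ∷ u) x n x0 (e , b)  | 𝟏 = x0 , x1 , ih
Begins-decode (𝟏 ∷ u) x n x0 (e , b)  | 𝟎 = x0 , ih
Begins-decode (𝟎 ∷ u) x n x0 (() , b) | 𝟎
Begins-decode (𝟏 ∷ u) x n x0 (() , b) | 𝟏

Start010 : Word∞ Bit → Set
Start010 x = x 0 ≡ 𝟎 × x 1 ≡ 𝟏 × x 2 ≡ 𝟎

Good : Word∞ Bit → Set
Good x = No11 x × NoPower x × Start010 x

-- The image of 11 and one more letter starts with 000, the 4⁻-power of the period 0.
decode-No11 : ∀ x → Good x → No11 (decode x)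
decode-No11 x (n11 , np , x0 , _) p b with Begins-extend (p ++ 𝟏 ∷ 𝟏 ∷ []) (decode x) b
... | a , b′ with b″ ← subst (λ w → Begins w x) (φ-++ p (𝟏 ∷ 𝟏 ∷ a ∷ []))
                        (Begins-decode _ x n11 x0 (subst (λ w → Begins w (decode x)) (++-assoc p _ _) b′))
  with φ-∷≡𝟎∷ a []
... | t , e = np (φ p) [] 𝟎 (Begins-++ (φ p ++ 𝟎 ∷ 𝟎 ∷ 𝟎 ∷ []) t x
      (subst (λ w → Begins w x) (trans (cong (λ w → φ p ++ 𝟎 ∷ 𝟎 ∷ w) e) (sym (++-assoc (φ p) _ t))) b″))

decode-NoPower : ∀ x → Good x → NoPower (decode x)
decode-NoPower x (n11 , np , x0 , _) p Y c b with Begins-extend (p ++ quad Y [ c ] []) (decode x) b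
... | a , b′ with φ-power p Y c a []
... | Y′ , c′ , r , e = np (φ p) Y′ c′ (Begins-++ (φ p ++ quad Y′ [ c′ ] []) r x
  (subst (λ w → Begins w x)
    (trans e (trans (cong (φ p ++_) (sym (quad-++ Y′ [ c′ ] [] r))) (sym (++-assoc (φ p) _ r))))
    (Begins-decode _ x n11 x0 (subst (λ w → Begins w (decode x))
      (trans (++-assoc p _ [ a ]) (cong (p ++_) (quad-++ Y [ c ] [] [ a ]))) b′))))

opOf : Bit → Op
opOf 𝟎 = β
opOf 𝟏 = α

first-op : Word∞ Bit → Op
first-op x = opOf (decode x 1)

-- For x starting with 010, `decode x` starts with 0; if a second 0 follows, the first is the one
-- inserted by β and is removed.
step : Word∞ Bit → Word∞ Bit
step x with decode x 1
... | 𝟎 = tl (decode x)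
... | 𝟏 = decode x

ops : Word∞ Bit → Word∞ Op
ops x zero    = first-op x
ops x (suc n) = ops (step x) n

Good-step : ∀ x → Good x → Good (step x)
Good-step x g@(_ , _ , x0 , x1 , _) with decode-No11 x g | decode-NoPower x g
... | n11 | np with decode x 1 in z1
Good-step x g@(_ , _ , x0 , x1 , _) | n11 | np | 𝟏 = n11 , np , cong decodeBit x1 , z1 , z2
  where
  z2 : decode x 2 ≡ 𝟎
  z2 with decode x 2 in e
  ... | 𝟎 = refl
  ... | 𝟏 = ⊥-elim (n11 [ decode x 0 ] (refl , z1 , e , tt))
Good-step x g@(_ , _ , x0 , x1 , _) | n11 | np | 𝟎 =
  No11-tl (decode x) n11 , (λ p Y c b → np (decode x 0 ∷ p) Y c (refl , b)) , z1 , z2 , z3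
  where
  z2 : decode x 2 ≡ 𝟏
  z2 with decode x 2 in e
  ... | 𝟏 = refl
  ... | 𝟎 = ⊥-elim (np [] [] 𝟎 (cong decodeBit x1 , z1 , e , tt))
  z3 : decode x 3 ≡ 𝟎
  z3 with decode x 3 in e
  ... | 𝟎 = refl
  ... | 𝟏 = ⊥-elim (n11 (decode x 0 ∷ decode x 1 ∷ []) (refl , refl , z2 , e , tt))

Begins-word-ops : ∀ m x → Good x → Begins (word m (ops x)) x
Begins-word-ops zero    x (_ , _ , x0 , x1 , x2) = x0 , x1 , x2 , tt
Begins-word-ops (suc m) x g@(n11 , _ , x0 , x1 , _) =
  Begins-decode _ x n11 x0 (unstep (Begins-word-ops m (step x) (Good-step x g)))
  where
  unstep : ∀ {w} → Begins w (step x) → Begins (sep (first-op x) ++ w) (decode x)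
  unstep b with decode x 1
  ... | 𝟎 = cong decodeBit x1 , b
  ... | 𝟏 = b

length-word : ∀ m f → m ≤ length (word m f)
length-word zero    f = z≤n
length-word (suc m) f with word-grows m f
... | a , r , e = begin
  suc m                                ≤⟨ s≤s (length-word m f) ⟩
  suc (length (word m f))              ≤⟨ s≤s (m≤m+n _ (length r)) ⟩
  suc (length (word m f) + length r)   ≡⟨ +-suc (length (word m f)) (length r) ⟨
  length (word m f) + suc (length r)   ≡⟨ length-++ (word m f) ⟨
  length (word m f ++ a ∷ r)           ≡⟨ cong length e ⟨
  length (word (suc m) f)              ∎
  where open ≤-Reasoning

-- Passage to the limit.

Begins-word : ∀ u x f → (∀ m → Begins (word m f) x) → Begins u x → ∃₂ λ m r → u ++ r ≡ word m f
Begins-word u x f bf bu = length u , Begins-prefix u _ x bu (bf (length u)) (length-word (length u) f)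

limit-NoPower⇒InV : ∀ x f → (∀ m → Begins (word m f) x) → NoPower x → InV f
limit-NoPower⇒InV x f bf np h with Bad⇒HasPower f (HasFactor-F⇒Bad f h)
... | m , p , Y , b , r , e = np p Y b (Begins-++ (p ++ quad Y [ b ] []) r x
  (subst (λ w → Begins w x)
    (sym (trans (++-assoc p _ r) (trans (cong (p ++_) (quad-++ Y [ b ] [] r)) e))) (bf m)))

limit-No11 : ∀ x f → (∀ m → Begins (word m f) x) → No11 x
limit-No11 x f bf p b with Begins-word _ x f bf b
... | m , r , e = Ok-suffix p (subst Ok (trans (sym e) (++-assoc p _ r)) (Ok-word m f))

limit-InV⇒NoPower : ∀ x f → (∀ m → Begins (word m f) x) → InV f → NoPower x
limit-InV⇒NoPower x f bf v p Y c b with Begins-word _ x f bf b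
... | m , r , e = no-power (suc (length Y)) f (v ∘ Bad⇒HasFactor-F f) m p Y c
  (trans (trans (cong (p ++_) (sym (quad-++ Y [ c ] [] r))) (sym (++-assoc p _ r))) e) ≤-refl

theorem7 : (x : Word∞ Bit) → IsPrefix (𝟎 ∷ 𝟏 ∷ 𝟎 ∷ []) x →
    (FauxBonacci x ⇔ Σ (Word∞ Op) λ f → InV f × ([] •∞ f ≡ x))
theorem7 x x010 = mk⇔ to from
  where
  to : FauxBonacci x → Σ (Word∞ Op) λ f → InV f × ([] •∞ f ≡ x)
  to fb with FauxBonacci⇒ x fb | IsPrefix⇒Begins _ x x010
  ... | n11 , np | x0 , x1 , x2 , _ = ops x , limit-NoPower⇒InV x (ops x) begins np ,
      λ m → subst (λ w → IsPrefix w x) (sym (bulletFin≡word m (ops x))) (Begins⇒IsPrefix _ x (begins m))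
    where
    begins : ∀ m → Begins (word m (ops x)) x
    begins m = Begins-word-ops m x (n11 , np , x0 , x1 , x2)
  from : (Σ (Word∞ Op) λ f → InV f × ([] •∞ f ≡ x)) → FauxBonacci x
  from (f , v , lim) = ⇒FauxBonacci x (limit-No11 x f begins) (limit-InV⇒NoPower x f begins v)
    where
    begins : ∀ m → Begins (word m f) x
    begins m = IsPrefix⇒Begins _ x (subst (λ w → IsPrefix w x) (bulletFin≡word m f) (lim m))
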